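{- Let $p$ be an odd prime and let $\mathbb{P}=\mathbb{C}_p[x]$. For every polynomial $q(x)\in\mathbb{P}$, $$\int_{\mathbb{Z}_p}q(x+y)\,d\mu_{ -1}(y)=\left(\int_{\mathbb{Z}_p}e^{yt}\,d\mu_{ -1}(y)\right)q(x)=\frac{2}{e^t+1}\,q(x),$$ where in the second and third expressions the formal power series in $t$ acts on $q(x)$ as a differential operator, $t$ acting as $\frac{d}{dx}$.
   Context: $p$ is a fixed odd prime; $\mathbb{Z}_p$ is the ring of $p$-adic integers and $\mathbb{C}_p$ is the completion of the algebraic closure of $\mathbb{Q}_p$. Fermionic $p$-adic integral: for a continuous function $f:\mathbb{Z}_p\to\mathbb{C}_p$, $$\int_{\mathbb{Z}_p}f(x)\,d\mu_{ -1}(x)=\lim_{N\to\infty}\sum_{x=0}^{p^N-1}f(x)(-1)^x .$$ In $\int_{\mathbb{Z}_p}q(x+y)\,d\mu_{ -1}(y)$ the integration is in the variable $y\in\mathbb{Z}_p$, and the result is regarded as a function (polynomial) of $x$, $x\in\mathbb{C}_p$. $\mathcal{F}$ is the algebra of formal power series $f(t)=\sum_{k\ge0}\frac{a_k}{k!}t^k$ with $a_k\in\mathbb{C}_p$. It acts on $\mathbb{P}=\mathbb{C}_p[x]$ by $t^kq(x)=q^{(k)}(x)=\frac{d^kq(x)}{dx^k}$, i.e. $f(t)q(x)=\sum_{k\ge0}\frac{a_k}{k!}q^{(k)}(x)$ (a finite sum). The symbol $\int_{\mathbb{Z}_p}e^{yt}\,d\mu_{ -1}(y)$ denotes the formal power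 series $\sum_{k\ge0}\left(\int_{\mathbb{Z}_p}y^k\,d\mu_{ -1}(y)\right)\frac{t^k}{k!}\in\mathcal{F}$, and $\frac{2}{e^t+1}\in\mathcal{F}$ is the quotient in the ring of formal power series, with $e^t=\sum_{k\ge0}t^k/k!$. -}

module Defs where

open import Level using (Level; _⊔_) renaming (suc to lsuc)
open import Algebra.Bundles using (CommutativeRing)
open import Algebra.Bundles.Raw using (RawRing)
open import Algebra.Morphism.Structures using (IsRingMonomorphism)
import Algebra.Properties.CommutativeSemigroup
import Algebra.Properties.Monoid.Mult
import Algebra.Properties.Ring
import Algebra.Properties.Semiring.Exp
import Algebra.Properties.Semiring.Sum
open import Data.Fin.Base using (Fin; toℕ; zero; suc)
open import Data.Integer.Base as ℤ using (ℤ; +_; -[1+_])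
import Data.Integer.Properties as ℤ
open import Data.Integer.Divisibility.Signed as ℤ∣ using (_∣_; divides)
open import Data.Integer.Tactic.RingSolver using (solve-∀)
open import Data.List.Base as List using (List; []; _∷_)
open import Data.Nat.Base as ℕ using (ℕ; zero; suc; _!)
import Data.Nat.Divisibility as ℕ∣
open import Data.Nat.Primality using (Prime; prime⇒nonTrivial)
import Data.Nat.Properties as ℕ
open import Data.Product.Base using (∃; _×_; _,_; proj₁; proj₂)
open import Data.Rational.Base as ℚ using (ℚ)
import Data.Rational.Properties as ℚ
import Data.Rational.Unnormalised.Base as ℚᵘ
import Data.Rational.Unnormalised.Properties as ℚᵘ
open import Data.Vec.Functional as Vector using (Vector)
open import Function.Base using (_∘_)
open import Function.Bundles using (_⇔_; module Equivalence)
import Relation.Binary.Reasoning.Setoid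
open import Relation.Binary.Construct.Add.Supremum.NonStrict ℚ._≤_
  using (_≤⁺_; [_]; _≤⊤⁺; ≤⁺-trans)
open import Relation.Binary.PropositionalEquality as ≡ using (_≡_)
open import Relation.Nullary.Construct.Add.Supremum using (_⁺; [_]; ⊤⁺)
open import Relation.Nullary.Negation.Core using (¬_; contradiction)

-- ℤₚ is the inverse limit of the rings ℤ/pⁿ: an element is given by
-- integer representatives of its residues modulo p⁰, p¹, p², …

record ℤₚ (p : ℕ) : Set where
  constructor mkℤₚ
  field
    residue  : ℕ → ℤ
    coherent : ∀ n → + (p ℕ.^ n) ∣ residue (suc n) ℤ.- residue n

open ℤₚ public

module _ {p : ℕ} where

  private
    resp : ∀ {k a b} → a ≡ b → k ∣ a → k ∣ b
    resp {k} = ≡.subst (k ∣_)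

  infixl 6 _+ₚ_ _-ₚ_
  infixl 7 _*ₚ_
  infix  8 -ₚ_

  fromℤ : ℤ → ℤₚ p
  fromℤ i .residue  _ = i
  fromℤ i .coherent _ = resp (≡.sym (ℤ.+-inverseʳ i)) (divides (+ 0) ≡.refl)

  fromℕ : ℕ → ℤₚ p
  fromℕ n = fromℤ (+ n)

  _+ₚ_ : ℤₚ p → ℤₚ p → ℤₚ p
  (y +ₚ z) .residue  n = residue y n ℤ.+ residue z n
  (y +ₚ z) .coherent n = resp (lemma (residue y (suc n)) (residue y n) (residue z (suc n)) (residue z n))
    (ℤ∣.∣m∣n⇒∣m+n (coherent y n) (coherent z n))
    where
    lemma : ∀ a b c d → (a ℤ.- b) ℤ.+ (c ℤ.- d) ≡ (a ℤ.+ c) ℤ.- (b ℤ.+ d)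
    lemma = solve-∀

  _*ₚ_ : ℤₚ p → ℤₚ p → ℤₚ p
  (y *ₚ z) .residue  n = residue y n ℤ.* residue z n
  (y *ₚ z) .coherent n = resp (lemma (residue y (suc n)) (residue y n) (residue z (suc n)) (residue z n))
    (ℤ∣.∣m∣n⇒∣m+n (ℤ∣.∣m⇒∣m*n (residue z (suc n)) (coherent y n))
                  (ℤ∣.∣n⇒∣m*n (residue y n) (coherent z n)))
    where
    lemma : ∀ a b c d → (a ℤ.- b) ℤ.* c ℤ.+ b ℤ.* (c ℤ.- d)
                      ≡ a ℤ.* c ℤ.- b ℤ.* d
    lemma = solve-∀

  -ₚ_ : ℤₚ p → ℤₚ p
  (-ₚ y) .residue  n = ℤ.- residue y n
  (-ₚ y) .coherent n = resp (lemma (residue y (suc n)) (residue y n)) (ℤ∣.∣m⇒∣-m (coherent y n))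
    where
    lemma : ∀ a b → ℤ.- (a ℤ.- b) ≡ ℤ.- a ℤ.- ℤ.- b
    lemma = solve-∀

  _-ₚ_ : ℤₚ p → ℤₚ p → ℤₚ p
  y -ₚ z = y +ₚ (-ₚ z)

infix 4 _^_∣ₚ_ _≈ₚ_

_^_∣ₚ_ : (p n : ℕ) → ℤₚ p → Set
p ^ n ∣ₚ z = + (p ℕ.^ n) ∣ residue z n

_≈ₚ_ : ∀ {p} → ℤₚ p → ℤₚ p → Set
_≈ₚ_ {p} y z = ∀ n → p ^ n ∣ₚ (y -ₚ z)

-- Every element of ℚₚ is y / pᵐ for some y in ℤₚ.

infix 5 _/p^_

record ℚₚ (p : ℕ) : Set where
  constructor _/p^_
  field
    numerator : ℤₚ p
    exponent  : ℕ

ℚₚ-rawRing : ℕ → RawRing _ _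
ℚₚ-rawRing p = record
  { Carrier = ℚₚ p
  ; _≈_     = λ { (y /p^ m) (z /p^ n) → (p^ n *ₚ y) ≈ₚ (p^ m *ₚ z) }
  ; _+_     = λ { (y /p^ m) (z /p^ n) →
                  p^ n *ₚ y +ₚ p^ m *ₚ z /p^ m ℕ.+ n }
  ; _*_     = λ { (y /p^ m) (z /p^ n) → y *ₚ z /p^ m ℕ.+ n }
  ; -_      = λ { (y /p^ m) → -ₚ y /p^ m }
  ; 0#      = fromℕ 0 /p^ 0
  ; 1#      = fromℕ 1 /p^ 0
  }
  where
  p^_ : ℕ → ℤₚ p
  p^ n = fromℕ (p ℕ.^ n)

infixl 6 _+⁺_

_+⁺_ : ℚ ⁺ → ℚ ⁺ → ℚ ⁺
[ r ] +⁺ [ s ] = [ r ℚ.+ s ]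
[ _ ] +⁺ ⊤⁺    = ⊤⁺
⊤⁺    +⁺ _     = ⊤⁺

-- ℂₚ is determined only up to isomorphism, so it is given by its defining
-- properties: a field extension of ℚₚ, complete for a valuation extending
-- that of ℚₚ, in which the elements algebraic over ℚₚ form a dense,
-- algebraically closed subfield.  All absolute values on ℂₚ are rational
-- powers of p, so ∣ x ∣ₚ = p^(- v x) is recorded through the additive
-- valuation v with v p = 1 and v 0 = ∞ (written ⊤⁺).  By multiplicativity,
-- v-embed determines v on all of ℚₚ.

record ℂₚ (p : ℕ) (c ℓ : Level) : Set (lsuc (c ⊔ ℓ)) where
  field
    commutativeRing : CommutativeRing c ℓ

  open CommutativeRing commutativeRing public
  open Algebra.Properties.Semiring.Exp semiring public using (_^_)
  open Algebra.Properties.Semiring.Sum semiring public using (sum; sum-syntax)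

  field
    inverse : ∀ x → ¬ x ≈ 0# → ∃ λ x⁻¹ → x * x⁻¹ ≈ 1#

    embed        : ℚₚ p → Carrier
    embed-isMono : IsRingMonomorphism (ℚₚ-rawRing p) rawRing embed

    v       : Carrier → ℚ ⁺
    v-cong  : ∀ {x y} → x ≈ y → v x ≡ v y
    v-∞     : ∀ x → v x ≡ ⊤⁺ ⇔ x ≈ 0#
    v-*     : ∀ x y → v (x * y) ≡ v x +⁺ v y
    v-ultra : ∀ x y {r} → r ≤⁺ v x → r ≤⁺ v y → r ≤⁺ v (x + y)
    v-embed : ∀ z n → p ^ n ∣ₚ z ⇔ [ + n ℚ./ 1 ] ≤⁺ v (embed (z /p^ 0))

  infix 4 _≤v_

  _≤v_ : ℚ → Carrier → Set
  r ≤v x = [ r ] ≤⁺ v x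

  Cauchy : (ℕ → Carrier) → Set
  Cauchy s = ∀ r → ∃ λ N → ∀ m n → N ℕ.≤ m → N ℕ.≤ n → r ≤v s m - s n

  _⟶_ : (ℕ → Carrier) → Carrier → Set
  s ⟶ x = ∀ r → ∃ λ N → ∀ n → N ℕ.≤ n → r ≤v s n - x

  -- monic a x = xⁿ + aₙ₋₁ xⁿ⁻¹ + … + a₀

  monic : ∀ {n} → Vector Carrier n → Carrier → Carrier
  monic {n} a x = x ^ n + ∑[ i < n ] (a i * x ^ toℕ i)

  -- x is a root of a monic polynomial over ℚₚ; the degree n is then
  -- positive, since 1 ≉ 0.

  Algebraic : Carrier → Set ℓ
  Algebraic x = ∃ λ n → ∃ λ (a : Vector (ℚₚ p) n) → monic (embed ∘ a) x ≈ 0#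

  field
    complete : ∀ s → Cauchy s → ∃ λ x → s ⟶ x
    dense    : ∀ x r → ∃ λ α → Algebraic α × r ≤v x - α
    closed   : ∀ {n} (a : Vector Carrier (suc n)) → (∀ i → Algebraic (a i)) →
               ∃ λ α → Algebraic α × monic a α ≈ 0#

  ι : ℤₚ p → Carrier
  ι z = embed (z /p^ 0)

module Series {p c ℓ} (prime : Prime p) (K : ℂₚ p c ℓ) where

  open ℂₚ K
  open Algebra.Properties.Monoid.Mult +-monoid using () renaming (_×_ to _·_)
  open Algebra.Properties.Semiring.Sum semiring using (sum-cong-≋)
  open IsRingMonomorphism embed-isMono
    using (⟦⟧-cong; +-homo; 1#-homo; 0#-homo)
  open Relation.Binary.Reasoning.Setoid setoid
  private module R = Algebra.Properties.Ring ring

  private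
    instance
      p-nonTrivial : ℕ.NonTrivial p
      p-nonTrivial = prime⇒nonTrivial prime

      p-nonZero : ℕ.NonZero p
      p-nonZero = ℕ.nonTrivial⇒nonZero p

    n<p^n : ∀ n → n ℕ.< p ℕ.^ n
    n<p^n zero    = ℕ.s≤s ℕ.z≤n
    n<p^n (suc n) = ℕ.<-≤-trans
      (ℕ.s≤s (n<p^n n))
      (ℕ.^-monoʳ-< p (ℕ.nonTrivial⇒n>1 p) (ℕ.n<1+n n))

  ι-+ : ∀ y z → ι y + ι z ≈ ι (y +ₚ z)
  ι-+ y z = trans (sym (+-homo _ _))
    (⟦⟧-cong λ n → divides (+ 0) (lemma (residue y n) (residue z n)))
    where
    lemma : ∀ a b → + 1 ℤ.* (+ 1 ℤ.* a ℤ.+ + 1 ℤ.* b) ℤ.- + 1 ℤ.* (a ℤ.+ b) ≡ + 0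
    lemma = solve-∀

  ·1≈ι : ∀ n → n · 1# ≈ ι (fromℕ n)
  ·1≈ι zero    = sym 0#-homo
  ·1≈ι (suc n) = trans (+-cong (sym 1#-homo) (·1≈ι n)) (trans
    (ι-+ (fromℕ 1) (fromℕ n))
    (⟦⟧-cong λ _ → divides (+ 0) (ℤ.+-inverseʳ (+ 1 ℤ.* + suc n))))

  n·1≉0 : ∀ n .{{_ : ℕ.NonZero n}} → ¬ n · 1# ≈ 0#
  n·1≉0 n n≈0 = ℕ.<⇒≱ (n<p^n n) (ℕ∣.∣⇒≤ (ℤ∣.∣⇒∣ᵤ p^n∣n))
    where
    v≡∞ : v (ι (fromℕ n)) ≡ ⊤⁺
    v≡∞ = Equivalence.from (v-∞ _) (trans (sym (·1≈ι n)) n≈0)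

    p^n∣n : p ^ n ∣ₚ fromℕ n
    p^n∣n = Equivalence.from (v-embed (fromℕ n) n)
      (≡.subst ([ + n ℚ./ 1 ] ≤⁺_) (≡.sym v≡∞) (_ ≤⊤⁺))

  1/_! : ℕ → Carrier
  1/ k ! = proj₁ (inverse ((k !) · 1#) (n·1≉0 (k !) {{k ℕ.!≢0}}))

  -- A series is given by its ordinary coefficients: f stands for Σₖ f k tᵏ.

  PowerSeries : Set c
  PowerSeries = ℕ → Carrier

  infix  4 _≈ₛ_
  infixl 6 _+ₛ_
  infixl 7 _*ₛ_

  _≈ₛ_ : PowerSeries → PowerSeries → Set ℓ
  f ≈ₛ g = ∀ k → f k ≈ g k

  _+ₛ_ : PowerSeries → PowerSeries → PowerSeries
  (f +ₛ g) k = f k + g k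

  _*ₛ_ : PowerSeries → PowerSeries → PowerSeries
  (f *ₛ g) k = ∑[ i < suc k ] (f (toℕ i) * g (k ℕ.∸ toℕ i))

  constant : Carrier → PowerSeries
  constant a zero    = a
  constant a (suc _) = 0#

  -- Σₖ aₖ tᵏ/k!
  egf : (ℕ → Carrier) → PowerSeries
  egf a k = a k * 1/ k !

  eᵗ : PowerSeries
  eᵗ = egf (λ _ → 1#)

  -- h = quotient f g is the unique series with g h = f (see *ₛ-quotient):
  -- h k = (f k - Σ_{i<k} g (1+i) h (k-1-i)) / g 0, and
  -- previous k lists h (k-1), …, h 0.

  module Quotient (f g : PowerSeries) (g₀≉0 : ¬ g 0 ≈ 0#) where

    1/g₀ : Carrier
    1/g₀ = proj₁ (inverse (g 0) g₀≉0)

    previous : ∀ k → Vector Carrier k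
    next     : ℕ → Carrier

    next k = 1/g₀ * (f k - ∑[ i < k ] (g (suc (toℕ i)) * previous k i))

    previous zero    = Vector.[]
    previous (suc k) = next k Vector.∷ previous k

  quotient : (f g : PowerSeries) → ¬ g 0 ≈ 0# → PowerSeries
  quotient f g g₀≉0 = Quotient.next f g g₀≉0

  *ₛ-quotient : ∀ f g (g₀≉0 : ¬ g 0 ≈ 0#) → g *ₛ quotient f g g₀≉0 ≈ₛ f
  *ₛ-quotient f g g₀≉0 k = begin
    g 0 * h k + ∑[ i < k ] (g (suc (toℕ i)) * h (k ℕ.∸ suc (toℕ i)))
      ≈⟨ +-congˡ (sum-cong-≋ {k} λ i → *-congˡ (reflexive (≡.sym (previous-≡ k i)))) ⟩
    g 0 * (1/g₀ * (f k - s)) + s   ≈⟨ +-congʳ (sym (*-assoc _ _ _)) ⟩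
    g 0 * 1/g₀ * (f k - s) + s     ≈⟨ +-congʳ (*-congʳ (proj₂ (inverse (g 0) g₀≉0))) ⟩
    1# * (f k - s) + s             ≈⟨ +-congʳ (*-identityˡ _) ⟩
    f k - s + s                    ≈⟨ +-assoc _ _ _ ⟩
    f k + (- s + s)                ≈⟨ +-congˡ (-‿inverseˡ s) ⟩
    f k + 0#                       ≈⟨ +-identityʳ _ ⟩
    f k                            ∎
    where
    open Quotient f g g₀≉0

    h = quotient f g g₀≉0
    s = ∑[ i < k ] (g (suc (toℕ i)) * previous k i)

    previous-≡ : ∀ k (i : Fin k) → previous k i ≡ h (k ℕ.∸ suc (toℕ i))
    previous-≡ (suc k) zero    = ≡.refl
    previous-≡ (suc k) (suc i) = previous-≡ k i

  eᵗ+1-unit : ¬ (eᵗ +ₛ constant 1#) 0 ≈ 0#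
  eᵗ+1-unit eq = n·1≉0 2 (trans (sym 2≈) eq)
    where
    1/0!≈1 : 1/ 0 ! ≈ 1#
    1/0!≈1 = begin
      1/ 0 !                 ≈⟨ sym (*-identityˡ _) ⟩
      1# * 1/ 0 !            ≈⟨ *-congʳ (sym (+-identityʳ 1#)) ⟩
      (1# + 0#) * 1/ 0 !     ≈⟨ proj₂ (inverse ((0 !) · 1#) (n·1≉0 (0 !))) ⟩
      1#                     ∎

    2≈ : 1# * 1/ 0 ! + 1# ≈ 2 · 1#
    2≈ = +-cong (trans (*-identityˡ _) 1/0!≈1) (sym (+-identityʳ 1#))

  2/[eᵗ+1] : PowerSeries
  2/[eᵗ+1] = quotient (constant (1# + 1#)) (eᵗ +ₛ constant 1#) eᵗ+1-unit

  -- a₀ ∷ a₁ ∷ a₂ ∷ … stands for a₀ + a₁ x + a₂ x² + …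

  Polynomial : Set c
  Polynomial = List Carrier

  coefficient : Polynomial → ℕ → Carrier
  coefficient []      _       = 0#
  coefficient (a ∷ _) zero    = a
  coefficient (_ ∷ q) (suc i) = coefficient q i

  infix  4 _≈ₓ_
  infixl 6 _+ₓ_
  infixr 7 _•_

  _≈ₓ_ : Polynomial → Polynomial → Set ℓ
  q ≈ₓ r = ∀ i → coefficient q i ≈ coefficient r i

  _+ₓ_ : Polynomial → Polynomial → Polynomial
  []      +ₓ r       = r
  (a ∷ q) +ₓ []      = a ∷ q
  (a ∷ q) +ₓ (b ∷ r) = (a + b) ∷ (q +ₓ r)

  _•_ : Carrier → Polynomial → Polynomial
  a • q = List.map (a *_) q

  ⟦_⟧ : Polynomial → Carrier → Carrier
  ⟦ []    ⟧ x = 0#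
  ⟦ a ∷ q ⟧ x = a + x * ⟦ q ⟧ x

  -- multiplies the successive coefficients by k, k + 1, k + 2, …
  scaleFrom : ℕ → Polynomial → Polynomial
  scaleFrom _ []      = []
  scaleFrom k (a ∷ q) = k · a ∷ scaleFrom (suc k) q

  derivative : Polynomial → Polynomial
  derivative []      = []
  derivative (_ ∷ q) = scaleFrom 1 q

  derivative^ : ℕ → Polynomial → Polynomial
  derivative^ zero    q = q
  derivative^ (suc k) q = derivative (derivative^ k q)

  -- f(t) q = Σₖ f k q⁽ᵏ⁾, where q⁽ᵏ⁾ = 0 as soon as k ≥ length q.

  infixr 7 _▷_

  _▷_ : PowerSeries → Polynomial → Polynomial
  f ▷ q = List.foldr _+ₓ_ []
    (List.applyUpTo (λ k → f k • derivative^ k q) (List.length q))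

module Fermionic {p c ℓ} (prime : Prime p) (odd : ¬ 2 ℕ∣.∣ p) (K : ℂₚ p c ℓ) where

  open ℂₚ K
  open Series prime K public
  open Algebra.Properties.Semiring.Exp semiring using (^-homo-*; ^-assocʳ; ^-congʳ)
  open Algebra.Properties.Semiring.Sum semiring using (sum-cong-≋)
  open IsRingMonomorphism embed-isMono using (-‿homo; 1#-homo)
  open Relation.Binary.Reasoning.Setoid setoid
  private
    module R = Algebra.Properties.Ring ring
    open Algebra.Properties.CommutativeSemigroup
      (CommutativeRing.+-commutativeSemigroup commutativeRing) using (interchange)

  -- ℤₚ is compact, so continuity is expressed as uniform continuity, which
  -- is the constructively appropriate notion.

  Continuous : (ℤₚ p → Carrier) → Set
  Continuous f = ∀ r → ∃ λ n → ∀ y z → p ^ n ∣ₚ (y -ₚ z) → r ≤v f y - f z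

  partialSum : (ℤₚ p → Carrier) → ℕ → Carrier
  partialSum f N = ∑[ x < p ℕ.^ N ] (f (fromℕ (toℕ x)) * (- 1#) ^ toℕ x)

  module Congruence where

    ≤v-resp : ∀ {r x y} → x ≈ y → r ≤v x → r ≤v y
    ≤v-resp {r} x≈y = ≡.subst ([ r ] ≤⁺_) (v-cong x≈y)

    ≤v-weaken : ∀ {r s x} → r ℚ.≤ s → s ≤v x → r ≤v x
    ≤v-weaken r≤s = ≤⁺-trans ℚ.≤-trans [ r≤s ]

    ≤v-0 : ∀ r → r ≤v 0#
    ≤v-0 r = ≡.subst ([ r ] ≤⁺_) (≡.sym (Equivalence.from (v-∞ 0#) refl)) (_ ≤⊤⁺)

    ≤v-+ : ∀ {r x y} → r ≤v x → r ≤v y → r ≤v x + y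
    ≤v-+ = v-ultra _ _

    ≤v-* : ∀ {r s x y} → r ≤v x → s ≤v y → r ℚ.+ s ≤v x * y
    ≤v-* {r} {s} {x} {y} r≤x s≤y =
      ≡.subst ([ r ℚ.+ s ] ≤⁺_) (≡.sym (v-* x y)) (mono r≤x s≤y)
      where
      mono : ∀ {a b} → [ r ] ≤⁺ a → [ s ] ≤⁺ b → [ r ℚ.+ s ] ≤⁺ a +⁺ b
      mono [ p ]    [ q ]    = [ ℚ.+-mono-≤ p q ]
      mono [ p ]    (_ ≤⊤⁺)  = _ ≤⊤⁺
      mono (_ ≤⊤⁺)  _        = _ ≤⊤⁺

    0≤vι : ∀ z → ℚ.0ℚ ≤v ι z
    0≤vι z = Equivalence.to (v-embed z 0) (divides (residue z 0) (≡.sym (ℤ.*-identityʳ _)))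

    0≤v-1 : ℚ.0ℚ ≤v - 1#
    0≤v-1 = ≤v-resp (trans (-‿homo _) (-‿cong 1#-homo)) (0≤vι (-ₚ fromℕ 1))

    ≤v-neg : ∀ {r x} → r ≤v x → r ≤v - x
    ≤v-neg {r} {x} r≤x = ≤v-resp (R.-1*x≈-x x)
      (≡.subst (_≤v - 1# * x) (ℚ.+-identityˡ r) (≤v-* 0≤v-1 r≤x))

    0≤v±1 : ∀ n → ℚ.0ℚ ≤v (- 1#) ^ n
    0≤v±1 zero    = ≤v-resp 1#-homo (0≤vι (fromℕ 1))
    0≤v±1 (suc n) = ≡.subst (_≤v - 1# * (- 1#) ^ n) (ℚ.+-identityˡ ℚ.0ℚ)
      (≤v-* 0≤v-1 (0≤v±1 n))

    infix 4 _~⟨_⟩_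

    _~⟨_⟩_ : Carrier → ℚ → Carrier → Set
    x ~⟨ r ⟩ y = r ≤v x - y

    ~-reflexive : ∀ {r x y} → x ≈ y → x ~⟨ r ⟩ y
    ~-reflexive {r} x≈y =
      ≤v-resp (sym (trans (+-congʳ x≈y) (-‿inverseʳ _))) (≤v-0 r)

    -[x-y]≈y-x : ∀ x y → - (x - y) ≈ y - x
    -[x-y]≈y-x x y = begin
      - (x - y)     ≈⟨ sym (R.-‿+-comm x (- y)) ⟩
      - x + - (- y) ≈⟨ +-congˡ (R.-‿involutive y) ⟩
      - x + y       ≈⟨ +-comm _ _ ⟩
      y - x         ∎

    ~-sym : ∀ {r x y} → x ~⟨ r ⟩ y → y ~⟨ r ⟩ x
    ~-sym x~y = ≤v-resp (-[x-y]≈y-x _ _) (≤v-neg x~y)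

    telescope : ∀ x y z → (x - y) + (y - z) ≈ x - z
    telescope x y z = begin
      (x - y) + (y - z)   ≈⟨ +-assoc _ _ _ ⟩
      x + (- y + (y - z)) ≈⟨ +-congˡ (sym (+-assoc _ _ _)) ⟩
      x + (- y + y - z)   ≈⟨ +-congˡ (+-congʳ (-‿inverseˡ y)) ⟩
      x + (0# - z)        ≈⟨ +-congˡ (+-identityˡ _) ⟩
      x - z               ∎

    ~-trans : ∀ {r x y z} → x ~⟨ r ⟩ y → y ~⟨ r ⟩ z → x ~⟨ r ⟩ z
    ~-trans x~y y~z = ≤v-resp (telescope _ _ _) (≤v-+ x~y y~z)

    ~-+ : ∀ {r x y x′ y′} → x ~⟨ r ⟩ x′ → y ~⟨ r ⟩ y′ → x + y ~⟨ r ⟩ x′ + y′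
    ~-+ x~ y~ = ≤v-resp
      (trans (interchange _ _ _ _) (+-congˡ (R.-‿+-comm _ _))) (≤v-+ x~ y~)

    ~-neg : ∀ {r x y} → x ~⟨ r ⟩ y → - x ~⟨ r ⟩ - y
    ~-neg x~y = ≤v-resp (sym (R.-‿+-comm _ _)) (≤v-neg x~y)

    *-minus : ∀ x y z → x * (y - z) ≈ x * y - x * z
    *-minus x y z = trans (distribˡ _ _ _) (+-congˡ (sym (R.-‿distribʳ-* x z)))

    minus-* : ∀ x y z → (y - z) * x ≈ y * x - z * x
    minus-* x y z = trans (distribʳ _ _ _) (+-congˡ (sym (R.-‿distribˡ-* z x)))

    ~-*± : ∀ {r x y} n → x ~⟨ r ⟩ y → x * (- 1#) ^ n ~⟨ r ⟩ y * (- 1#) ^ n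
    ~-*± {r} {x} {y} n x~y = ≤v-resp (minus-* _ _ _)
      (≡.subst (_≤v (x - y) * (- 1#) ^ n) (ℚ.+-identityʳ r)
        (≤v-* x~y (0≤v±1 n)))

    alt : ℕ → (ℕ → Carrier) → Carrier
    alt n g = ∑[ x < n ] (g (toℕ x) * (- 1#) ^ toℕ x)

    alt-~ : ∀ {r} n {g h} → (∀ x → g x ~⟨ r ⟩ h x) → alt n g ~⟨ r ⟩ alt n h
    alt-~ {r} n {g} {h} g~h = go n λ i → ~-*± i (g~h i)
      where
      go : ∀ n {a b : ℕ → Carrier} → (∀ i → a i ~⟨ r ⟩ b i) →
           sum {n} (a ∘ toℕ) ~⟨ r ⟩ sum {n} (b ∘ toℕ)
      go zero    _   = ~-reflexive refl
      go (suc n) a~b = ~-+ (a~b 0) (go n (a~b ∘ suc))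

    sum-+ : ∀ m n (a : ℕ → Carrier) →
            sum {m ℕ.+ n} (a ∘ toℕ) ≈ sum {m} (a ∘ toℕ) + sum {n} (λ i → a (m ℕ.+ toℕ i))
    sum-+ zero    n a = sym (+-identityˡ _)
    sum-+ (suc m) n a = trans (+-congˡ (sum-+ m n (a ∘ suc))) (sym (+-assoc _ _ _))

    sum-neg : ∀ n (a : ℕ → Carrier) → sum {n} (λ i → - a (toℕ i)) ≈ - sum {n} (a ∘ toℕ)
    sum-neg zero    a = sym R.-0#≈0#
    sum-neg (suc n) a = trans (+-congˡ (sum-neg n (a ∘ suc))) (R.-‿+-comm _ _)

    odd# : ℕ → ℕ
    odd# h = suc (h ℕ.* 2)

    -1^odd : ∀ h → (- 1#) ^ odd# h ≈ - 1#
    -1^odd zero    = *-identityʳ _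
    -1^odd (suc h) = begin
      - 1# * (- 1# * (- 1#) ^ odd# h) ≈⟨ R.-1*x≈-x _ ⟩
      - (- 1# * (- 1#) ^ odd# h)      ≈⟨ -‿cong (R.-1*x≈-x _) ⟩
      - (- (- 1#) ^ odd# h)           ≈⟨ R.-‿involutive _ ⟩
      (- 1#) ^ odd# h                 ≈⟨ -1^odd h ⟩
      - 1#                            ∎

    alt-block : ∀ {r M} g n → (- 1#) ^ M ≈ - 1# → (∀ x → g (M ℕ.+ x) ~⟨ r ⟩ g x) →
                alt (M ℕ.+ n) g ~⟨ r ⟩ alt M g - alt n g
    alt-block {r} {M} g n -1^M per = ~-trans
      (~-reflexive (trans (sum-+ M n a) (+-congˡ shifted)))
      (~-+ (~-reflexive refl) (~-neg (alt-~ n per)))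
      where
      a = λ x → g x * (- 1#) ^ x

      sign : ∀ x → a (M ℕ.+ x) ≈ - (g (M ℕ.+ x) * (- 1#) ^ x)
      sign x = begin
        g (M ℕ.+ x) * (- 1#) ^ (M ℕ.+ x)
          ≈⟨ *-congˡ (trans (^-homo-* _ M x) (*-congʳ -1^M)) ⟩
        g (M ℕ.+ x) * (- 1# * (- 1#) ^ x)     ≈⟨ *-congˡ (R.-1*x≈-x _) ⟩
        g (M ℕ.+ x) * - (- 1#) ^ x            ≈⟨ sym (R.-‿distribʳ-* _ _) ⟩
        - (g (M ℕ.+ x) * (- 1#) ^ x)          ∎

      shifted : sum {n} (λ i → a (M ℕ.+ toℕ i)) ≈ - alt n (λ x → g (M ℕ.+ x))
      shifted = trans (sum-cong-≋ {n} (λ i → sign (toℕ i)))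
        (sum-neg n (λ x → g (M ℕ.+ x) * (- 1#) ^ x))

    alt-odd : ∀ {r M} g h → (- 1#) ^ M ≈ - 1# → (∀ x → g (M ℕ.+ x) ~⟨ r ⟩ g x) →
              alt (odd# h ℕ.* M) g ~⟨ r ⟩ alt M g
    alt-odd {r} {M} g zero -1^M per =
      ~-reflexive (reflexive (≡.cong (λ m → alt m g) (ℕ.+-identityʳ M)))
    alt-odd {r} {M} g (suc h) -1^M per = ~-trans
      (alt-block g (M ℕ.+ odd# h ℕ.* M) -1^M per)
      (~-trans
        (~-+ (~-reflexive refl) (~-neg (alt-block g (odd# h ℕ.* M) -1^M per)))
        (~-trans (~-reflexive cancel) (alt-odd g h -1^M per)))
      where
      A = alt M g
      B = alt (odd# h ℕ.* M) g

      cancel : A - (A - B) ≈ B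
      cancel = begin
        A - (A - B)   ≈⟨ +-congˡ (-[x-y]≈y-x A B) ⟩
        A + (B - A)   ≈⟨ +-comm _ _ ⟩
        B - A + A     ≈⟨ +-assoc _ _ _ ⟩
        B + (- A + A) ≈⟨ +-congˡ (-‿inverseˡ A) ⟩
        B + 0#        ≈⟨ +-identityʳ B ⟩
        B             ∎

    half : ∀ n → ¬ 2 ℕ∣.∣ n → ∃ λ h → n ≡ odd# h
    half zero          2∤n = contradiction (2 ℕ∣.∣0) 2∤n
    half (suc zero)    2∤n = 0 , ≡.refl
    half (suc (suc n)) 2∤n with half n (λ 2∣n → 2∤n (ℕ∣.∣m∣n⇒∣m+n (ℕ∣.∣-refl {2}) 2∣n))
    ... | h , eq = suc h , ≡.cong (2 ℕ.+_) eq

    p≡odd : p ≡ odd# (proj₁ (half p odd))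
    p≡odd = proj₂ (half p odd)

    -1^p^N : ∀ N → (- 1#) ^ (p ℕ.^ N) ≈ - 1#
    -1^p^N zero    = *-identityʳ _
    -1^p^N (suc N) = begin
      (- 1#) ^ (p ℕ.* p ℕ.^ N)    ≈⟨ sym (^-assocʳ (- 1#) p (p ℕ.^ N)) ⟩
      ((- 1#) ^ p) ^ (p ℕ.^ N)    ≈⟨ ^-cong′ (p ℕ.^ N) -1^p ⟩
      (- 1#) ^ (p ℕ.^ N)          ≈⟨ -1^p^N N ⟩
      - 1#                        ∎
      where
      open Algebra.Properties.Semiring.Exp semiring using () renaming (^-congˡ to ^-cong′)

      -1^p : (- 1#) ^ p ≈ - 1#
      -1^p = trans (^-congʳ (- 1#) p≡odd) (-1^odd (proj₁ (half p odd)))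

    ∣ₚ-pred : ∀ n z → p ^ suc n ∣ₚ z → p ^ n ∣ₚ z
    ∣ₚ-pred n z d = ≡.subst (+ (p ℕ.^ n) ∣_) (lemma (residue z (suc n)) (residue z n))
      (ℤ∣.∣m∣n⇒∣m+n (ℤ∣.∣-trans (ℤ∣.∣ᵤ⇒∣ (ℕ∣.divides p ≡.refl)) d)
                    (ℤ∣.∣m⇒∣-m (coherent z n)))
      where
      lemma : ∀ a b → a ℤ.+ ℤ.- (a ℤ.- b) ≡ b
      lemma = solve-∀

    ∣ₚ-weaken : ∀ m n z → p ^ (m ℕ.+ n) ∣ₚ z → p ^ n ∣ₚ z
    ∣ₚ-weaken zero    n z d = d
    ∣ₚ-weaken (suc m) n z d = ∣ₚ-weaken m n z (∣ₚ-pred (m ℕ.+ n) z d)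

    partialSum-step : ∀ f r n →
      (∀ y z → p ^ n ∣ₚ (y -ₚ z) → r ≤v f y - f z) →
      ∀ k → partialSum f (suc (k ℕ.+ n)) ~⟨ r ⟩ partialSum f (k ℕ.+ n)
    partialSum-step f r n mod k = ~-trans
      (~-reflexive (reflexive (≡.cong (λ m → alt (m ℕ.* p ℕ.^ N) g) p≡odd)))
      (alt-odd g (proj₁ (half p odd)) (-1^p^N N) periodic)
      where
      N = k ℕ.+ n
      g = λ x → f (fromℕ x)

      lemma : ∀ a b → a ≡ (a ℤ.+ b) ℤ.- b
      lemma = solve-∀

      periodic : ∀ x → g (p ℕ.^ N ℕ.+ x) ~⟨ r ⟩ g x
      periodic x = mod _ _ (∣ₚ-weaken k n (fromℕ (p ℕ.^ N ℕ.+ x) -ₚ fromℕ x)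
        (≡.subst (+ (p ℕ.^ N) ∣_) (lemma (+ (p ℕ.^ N)) (+ x)) ℤ∣.∣-refl))

  open Congruence

  partialSum-cauchy : ∀ f → Continuous f → Cauchy (partialSum f)
  partialSum-cauchy f cont r = n , λ i j n≤i n≤j → ~-trans (near i n≤i) (~-sym (near j n≤j))
    where
    n = proj₁ (cont r)

    near+ : ∀ k → partialSum f (k ℕ.+ n) ~⟨ r ⟩ partialSum f n
    near+ zero    = ~-reflexive refl
    near+ (suc k) = ~-trans (partialSum-step f r n (proj₂ (cont r)) k) (near+ k)

    near : ∀ i → n ℕ.≤ i → partialSum f i ~⟨ r ⟩ partialSum f n
    near i n≤i = ≡.subst (λ j → partialSum f j ~⟨ r ⟩ partialSum f n)
      (ℕ.m∸n+n≡m n≤i) (near+ (i ℕ.∸ n))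

  ∫ : (f : ℤₚ p → Carrier) → Continuous f → Carrier
  ∫ f cont = proj₁ (complete (partialSum f) (partialSum-cauchy f cont))

  module Continuity where

    Bounded : (ℤₚ p → Carrier) → Set
    Bounded f = ∃ λ r → ∀ y → r ≤v f y

    Good : (ℤₚ p → Carrier) → Set
    Good f = Continuous f × Bounded f

    bound : ∀ x → ∃ λ r → r ≤v x
    bound x = go (v x) ≡.refl
      where
      go : ∀ a → v x ≡ a → ∃ λ r → r ≤v x
      go [ r ] eq = r , ≡.subst ([ r ] ≤⁺_) (≡.sym eq) [ ℚ.≤-refl ]
      go ⊤⁺    eq = ℚ.0ℚ , ≡.subst ([ ℚ.0ℚ ] ≤⁺_) (≡.sym eq) (_ ≤⊤⁺)

    good-const : ∀ x → Good (λ _ → x)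
    good-const x = (λ r → 0 , λ _ _ _ → ~-reflexive refl)
                 , (proj₁ (bound x) , λ _ → proj₂ (bound x))

    combine : ∀ {f g : ℤₚ p → Carrier} {r s} →
      (∃ λ n → ∀ y z → p ^ n ∣ₚ (y -ₚ z) → r ≤v f y - f z) →
      (∃ λ n → ∀ y z → p ^ n ∣ₚ (y -ₚ z) → s ≤v g y - g z) →
      ∃ λ n → ∀ y z → p ^ n ∣ₚ (y -ₚ z) → r ≤v f y - f z × s ≤v g y - g z
    combine (m , f~) (n , g~) = m ℕ.+ n , λ y z d →
      f~ y z (∣ₚ-weaken n m (y -ₚ z)
        (≡.subst (λ k → p ^ k ∣ₚ (y -ₚ z)) (ℕ.+-comm m n) d)) ,
      g~ y z (∣ₚ-weaken m n (y -ₚ z) d)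

    good-+ : ∀ {f g} → Good f → Good g → Good (λ y → f y + g y)
    good-+ (cf , bf , f≥) (cg , bg , g≥) =
      (λ r → let n , h = combine (cf r) (cg r) in
        n , λ y z d → ~-+ (proj₁ (h y z d)) (proj₂ (h y z d))) ,
      bf ℚ.⊓ bg , λ y → ≤v-+ (≤v-weaken (ℚ.p⊓q≤p bf bg) (f≥ y))
                              (≤v-weaken (ℚ.p⊓q≤q bf bg) (g≥ y))

    ℚ-cancel : ∀ r b → b ℚ.+ (r ℚ.- b) ≡ r
    ℚ-cancel r b = ≡.trans (ℚ.+-comm b (r ℚ.- b)) (≡.trans (ℚ.+-assoc r (ℚ.- b) b)
      (≡.trans (≡.cong (r ℚ.+_) (ℚ.+-inverseˡ b)) (ℚ.+-identityʳ r)))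

    good-* : ∀ {f g} → Good f → Good g → Good (λ y → f y * g y)
    good-* {f} {g} (cf , bf , f≥) (cg , bg , g≥) =
      (λ r → let n , h = combine (cf (r ℚ.- bg)) (cg (r ℚ.- bf)) in
        n , λ y z d → ~-trans
          (≤v-resp (*-minus _ _ _) (≡.subst (_≤v f y * (g y - g z)) (ℚ-cancel r bf)
            (≤v-* (f≥ y) (proj₂ (h y z d)))))
          (≤v-resp (minus-* _ _ _) (≡.subst (_≤v (f y - f z) * g z)
            (≡.trans (ℚ.+-comm (r ℚ.- bg) bg) (ℚ-cancel r bg))
            (≤v-* (proj₁ (h y z d)) (g≥ z))))) ,
      bf ℚ.+ bg , λ y → ≤v-* (f≥ y) (g≥ y)

    ι-minus : ∀ y z → ι y - ι z ≈ ι (y -ₚ z)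
    ι-minus y z = trans (+-congˡ (sym (-‿homo _))) (ι-+ y (-ₚ z))

    archimedean : ∀ r → ∃ λ n → r ℚ.≤ + n ℚ./ 1
    archimedean r@(ℚ.mkℚ a d _) = ℤ.∣ a ∣ , ℚ.toℚᵘ-cancel-≤
      (ℚᵘ.≤-trans (ℚᵘ.*≤* a≤)
        (ℚᵘ.≤-reflexive (ℚᵘ.≃-sym (ℚ.toℚᵘ-fromℚᵘ (ℚᵘ.mkℚᵘ (+ ℤ.∣ a ∣) 0)))))
      where
      i≤∣i∣ : ∀ i → i ℤ.≤ + ℤ.∣ i ∣
      i≤∣i∣ (+ _)    = ℤ.≤-refl
      i≤∣i∣ -[1+ _ ] = ℤ.-≤+

      a≤ : a ℤ.* + 1 ℤ.≤ + ℤ.∣ a ∣ ℤ.* + suc d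
      a≤ = ℤ.≤-trans (ℤ.≤-reflexive (ℤ.*-identityʳ a)) (ℤ.≤-trans (i≤∣i∣ a)
        (ℤ.≤-trans (ℤ.+≤+ (ℕ.m≤m*n ℤ.∣ a ∣ (suc d)))
          (ℤ.≤-reflexive (ℤ.pos-* ℤ.∣ a ∣ (suc d)))))

    good-ι : Good ι
    good-ι = (λ r → let n , r≤n = archimedean r in
        n , λ y z d → ≤v-resp (sym (ι-minus y z))
          (≤v-weaken r≤n (Equivalence.to (v-embed (y -ₚ z) n) d))) ,
      ℚ.0ℚ , 0≤vι

    good-poly : ∀ q {f} → Good f → Good (λ y → ⟦ q ⟧ (f y))
    good-poly []      _      = good-const 0#
    good-poly (a ∷ q) good-f = good-+ (good-const a) (good-* good-f (good-poly q good-f))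

    good-^ : ∀ k → Good (λ y → ι y ^ k)
    good-^ zero    = good-const 1#
    good-^ (suc k) = good-* good-ι (good-^ k)

  open Continuity

  polynomial-continuous : ∀ q x → Continuous (λ y → ⟦ q ⟧ (x + ι y))
  polynomial-continuous q x = proj₁ (good-poly q (good-+ (good-const x) good-ι))

  power-continuous : ∀ k → Continuous (λ y → ι y ^ k)
  power-continuous k = proj₁ (good-^ k)

  -- ∫ e^{yt} dμ₋₁(y), the exponential generating function of the moments.

  ∫eʸᵗ : PowerSeries
  ∫eʸᵗ = egf (λ k → ∫ (λ y → ι y ^ k) (power-continuous k))

{-# OPTIONS --safe #-}

-- The polynomial q(x + y) has the Taylor expansion Σₖ q⁽ᵏ⁾(x) yᵏ/k!, so the
-- first equality is linearity of the integral.  For the second, telescoping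
-- the alternating sums over 0 ≤ x < pᴺ (an odd number of terms) gives
-- ∫ f(y + 1) + ∫ f(y) = 2 f(0) for continuous f.  Applied to f(y) = yᵏ/k!, with
-- e^{(1+y)t} = eᵗ e^{yt}, this says (eᵗ + 1) ∫ e^{yt} = 2.

module Submission where

open import Defs
open import Level using (Level)
open import Algebra.Bundles using (CommutativeRing)
open import Algebra.Morphism.Structures using (IsRingMonomorphism)
import Algebra.Properties.CommutativeSemiring.Binomial
import Algebra.Properties.CommutativeSemigroup
import Algebra.Properties.Ring
import Algebra.Properties.Semiring.Exp
import Algebra.Properties.Semiring.Mult
import Algebra.Properties.Semiring.Sum
open import Data.Fin.Base as Fin using (Fin; toℕ; suc)
import Data.Fin.Properties as Fin
open import Data.Integer.Base using (+_)
import Data.Integer.Divisibility.Signed as ℤ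
import Data.Integer.Properties as ℤ
open import Data.List.Base using ([]; _∷_; length; foldr; applyUpTo)
open import Data.Nat.Base as ℕ using (ℕ; zero; suc; _!; s≤s)
open import Data.Nat.Combinatorics using (_C_; nCk≡n!/k![n-k]!; [n∸k]!k!∣n!)
open import Data.Nat.Divisibility as ℕ using (_∣_)
import Data.Nat.DivMod as ℕ
open import Data.Nat.Induction using (<-rec)
open import Data.Nat.Primality using (Prime)
import Data.Nat.Properties as ℕ
open import Data.Product.Base using (_×_; _,_; proj₁; proj₂)
open import Data.Rational.Base as ℚ using (ℚ)
import Data.Rational.Properties as ℚ
open import Function.Base using (_∘_)
open import Function.Bundles using (module Equivalence)
open import Relation.Binary.Construct.Add.Supremum.NonStrict ℚ._≤_ using (_≤⁺_; [_])
open import Relation.Binary.PropositionalEquality as ≡ using (_≡_)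
import Relation.Binary.Reasoning.Setoid
open import Relation.Nullary.Construct.Add.Supremum using (_⁺; [_]; ⊤⁺)
open import Relation.Nullary.Negation.Core using (¬_; contradiction)

-- The quotient formula for `n C k` uses truncating division, which is exact here because k! (n-k)!
-- divides n!. The bracketing lets the factorials be split off one at a time in `nCk·1/n!`.
k!*[n∸k]!*nCk≡n! : ∀ {n k} → k ℕ.≤ n → k ! ℕ.* ((n ℕ.∸ k) ! ℕ.* (n C k)) ≡ n !
k!*[n∸k]!*nCk≡n! {n} {k} k≤n = begin
  k ! ℕ.* ((n ℕ.∸ k) ! ℕ.* (n C k))    ≡⟨ ℕ.*-assoc (k !) _ _ ⟨
  d ℕ.* (n C k)                        ≡⟨ ℕ.*-comm d (n C k) ⟩
  (n C k) ℕ.* d                        ≡⟨ ≡.cong (ℕ._* d) (nCk≡n!/k![n-k]! k≤n) ⟩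
  (n ! ℕ./ d) ℕ.* d                    ≡⟨ ℕ.m/n*n≡m d∣n! ⟩
  n !                                  ∎
  where
  open ≡.≡-Reasoning
  d = k ! ℕ.* (n ℕ.∸ k) !
  instance
    d≢0 : ℕ.NonZero d
    d≢0 = k ℕ.!* (n ℕ.∸ k) !≢0
  d∣n! : d ∣ n !
  d∣n! = ≡.subst (_∣ n !) (ℕ.*-comm ((n ℕ.∸ k) !) (k !)) ([n∸k]!k!∣n! k≤n)

module SeriesProperties {p : ℕ} {c ℓ : Level} (prime : Prime p) (K : ℂₚ p c ℓ) where

  open ℂₚ K
  open Series prime K
  open Algebra.Properties.Semiring.Mult semiring
    using (×-homo-+; ×-congʳ; ×-congˡ; ×-assocˡ; ×-comm-*; ×-assoc-*) renaming (_×_ to _·_)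
  open Algebra.Properties.Semiring.Sum semiring
    using (sum-cong-≋; sum-replicate-zero; ∑-distrib-+; *-distribˡ-sum; *-distribʳ-sum)
  open Algebra.Properties.CommutativeSemigroup
    (CommutativeRing.+-commutativeSemigroup commutativeRing) using (interchange; x∙yz≈xz∙y)
  open Algebra.Properties.CommutativeSemigroup
    (CommutativeRing.*-commutativeSemigroup commutativeRing)
    using (x∙yz≈y∙xz) renaming (interchange to *-interchange)
  module Binomial = Algebra.Properties.CommutativeSemiring.Binomial
    (CommutativeRing.commutativeSemiring commutativeRing)
  private module R = Algebra.Properties.Ring ring
  open Relation.Binary.Reasoning.Setoid setoid

  -- Finite sums and natural multiples.

  ∑-zero : ∀ n {a : Fin n → Carrier} → (∀ i → a i ≈ 0#) → sum a ≈ 0#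
  ∑-zero n a≈0 = trans (sum-cong-≋ {n} a≈0) (sum-replicate-zero n)

  ·-zeroʳ : ∀ n → n · 0# ≈ 0#
  ·-zeroʳ zero    = refl
  ·-zeroʳ (suc n) = trans (+-identityˡ _) (·-zeroʳ n)

  ·≈* : ∀ n x → n · x ≈ n · 1# * x
  ·≈* n x = sym (trans (×-assoc-* n 1# x) (×-congʳ n (*-identityˡ x)))

  ·-comm-· : ∀ m n x → m · (n · x) ≈ n · (m · x)
  ·-comm-· m n x = trans (×-assocˡ x m n)
    (trans (×-congˡ {x} (ℕ.*-comm m n)) (sym (×-assocˡ x n m)))

  1^ : ∀ k → 1# ^ k ≈ 1#
  1^ zero    = refl
  1^ (suc k) = trans (*-identityˡ _) (1^ k)

  -- Inverse factorials and exponential series.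

  !·1/! : ∀ k → (k !) · 1/ k ! ≈ 1#
  !·1/! k = trans (·≈* (k !) _) (proj₂ (inverse _ _))

  -- Inverses are unique in a commutative ring. Since `1/ k !` is only some inverse supplied by the
  -- field, identities about it are proved by clearing the factorial and appealing to this.
  1/!-unique : ∀ k {x} → (k !) · x ≈ 1# → x ≈ 1/ k !
  1/!-unique k {x} k!x≈1 = begin
    x                       ≈⟨ *-identityʳ x ⟨
    x * 1#                  ≈⟨ *-congˡ (!·1/! k) ⟨
    x * ((k !) · 1/ k !)    ≈⟨ ×-comm-* (k !) x _ ⟩
    (k !) · (x * 1/ k !)    ≈⟨ ×-assoc-* (k !) x _ ⟨
    (k !) · x * 1/ k !      ≈⟨ *-congʳ k!x≈1 ⟩
    1# * 1/ k !             ≈⟨ *-identityˡ _ ⟩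
    1/ k !                  ∎

  1/0!≈1 : 1/ 0 ! ≈ 1#
  1/0!≈1 = sym (1/!-unique 0 (+-identityʳ 1#))

  [1+k]·1/[1+k]! : ∀ k → suc k · 1/ suc k ! ≈ 1/ k !
  [1+k]·1/[1+k]! k = 1/!-unique k (trans (·-comm-· (k !) (suc k) _)
    (trans (×-assocˡ _ (suc k) (k !)) (!·1/! (suc k))))

  -- Multiplying the left side by (n-k)! and then by k! turns it into n!/n! = 1, so the two
  -- factorials can be inverted in turn.
  nCk·1/n! : ∀ {n k} → k ℕ.≤ n → (n C k) · 1/ n ! ≈ 1/ k ! * 1/ (n ℕ.∸ k) !
  nCk·1/n! {n} {k} k≤n = begin
    D                         ≈⟨ *-identityʳ D ⟨
    D * 1#                    ≈⟨ *-congˡ (!·1/! m) ⟨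
    D * ((m !) · 1/ m !)      ≈⟨ ×-comm-* (m !) D _ ⟩
    (m !) · (D * 1/ m !)      ≈⟨ ×-assoc-* (m !) D _ ⟨
    (m !) · D * 1/ m !        ≈⟨ *-congʳ (1/!-unique k k!m!D≈1) ⟩
    1/ k ! * 1/ m !           ∎
    where
    m = n ℕ.∸ k
    D = (n C k) · 1/ n !

    k!m!D≈1 : (k !) · ((m !) · D) ≈ 1#
    k!m!D≈1 = begin
      (k !) · ((m !) · D)                            ≈⟨ ×-congʳ (k !) (×-assocˡ _ (m !) (n C k)) ⟩
      (k !) · ((m ! ℕ.* (n C k)) · 1/ n !)           ≈⟨ ×-assocˡ _ (k !) _ ⟩
      (k ! ℕ.* (m ! ℕ.* (n C k))) · 1/ n !           ≈⟨ ×-congˡ {1/ n !} (k!*[n∸k]!*nCk≡n! k≤n) ⟩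
      (n !) · 1/ n !                                 ≈⟨ !·1/! n ⟩
      1#                                             ∎

  -- `egf (x ^_)` is the series of e^{xt}, so this is the law e^{xt} e^{yt} = e^{(x+y)t}. In degree
  -- n it is the binomial theorem divided by n!.
  egf-^-*ₛ : ∀ x y → egf (x ^_) *ₛ egf (y ^_) ≈ₛ egf ((x + y) ^_)
  egf-^-*ₛ x y n = sym (begin
    (x + y) ^ n * 1/ n !                        ≈⟨ *-congʳ (Binomial.theorem n x y) ⟩
    sum (Binomial.binomialTerm x y n) * 1/ n !  ≈⟨ *-distribʳ-sum (1/ n !) (Binomial.binomialTerm x y n) ⟩
    sum {suc n} (λ i → Binomial.binomialTerm x y n i * 1/ n !)
      ≈⟨ sum-cong-≋ {suc n} (λ i → term (toℕ i) (ℕ.≤-pred (Fin.toℕ<n i))) ⟩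
    (egf (x ^_) *ₛ egf (y ^_)) n                ∎)
    where
    term : ∀ k → k ℕ.≤ n → (n C k) · (x ^ k * y ^ (n ℕ.∸ k)) * 1/ n !
                         ≈ (x ^ k * 1/ k !) * (y ^ (n ℕ.∸ k) * 1/ (n ℕ.∸ k) !)
    term k k≤n = begin
      (n C k) · z * 1/ n !              ≈⟨ ×-assoc-* (n C k) z _ ⟩
      (n C k) · (z * 1/ n !)            ≈⟨ ×-comm-* (n C k) z _ ⟨
      z * ((n C k) · 1/ n !)            ≈⟨ *-congˡ (nCk·1/n! k≤n) ⟩
      z * (1/ k ! * 1/ (n ℕ.∸ k) !)     ≈⟨ *-interchange _ _ _ _ ⟩
      _                                 ∎
      where z = x ^ k * y ^ (n ℕ.∸ k)

  -- Multiplication and cancellation of power series.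

  *ₛ-congʳ : ∀ {f g} h → f ≈ₛ g → f *ₛ h ≈ₛ g *ₛ h
  *ₛ-congʳ h f≈g k = sum-cong-≋ {suc k} (λ i → *-congʳ {h (k ℕ.∸ toℕ i)} (f≈g (toℕ i)))

  *ₛ-distribʳ : ∀ h f g → (f +ₛ g) *ₛ h ≈ₛ (f *ₛ h) +ₛ (g *ₛ h)
  *ₛ-distribʳ h f g k = trans
    (sum-cong-≋ {suc k} (λ i → distribʳ (h (k ℕ.∸ toℕ i)) (f (toℕ i)) (g (toℕ i))))
    (∑-distrib-+ {suc k} (λ i → f (toℕ i) * h (k ℕ.∸ toℕ i)) (λ i → g (toℕ i) * h (k ℕ.∸ toℕ i)))

  constant-*ₛ : ∀ a h k → (constant a *ₛ h) k ≈ a * h k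
  constant-*ₛ a h k = trans (+-congˡ (∑-zero k λ _ → zeroˡ _)) (+-identityʳ _)

  *-cancelˡ : ∀ a {x y} → ¬ a ≈ 0# → a * x ≈ a * y → x ≈ y
  *-cancelˡ a {x} {y} a≉0 ax≈ay = begin
    x                 ≈⟨ undo x ⟨
    a⁻¹ * (a * x)     ≈⟨ *-congˡ ax≈ay ⟩
    a⁻¹ * (a * y)     ≈⟨ undo y ⟩
    y                 ∎
    where
    a⁻¹ = proj₁ (inverse a a≉0)

    undo : ∀ z → a⁻¹ * (a * z) ≈ z
    undo z = begin
      a⁻¹ * (a * z)   ≈⟨ x∙yz≈y∙xz a⁻¹ a z ⟩
      a * (a⁻¹ * z)   ≈⟨ *-assoc a a⁻¹ z ⟨
      a * a⁻¹ * z     ≈⟨ *-congʳ (proj₂ (inverse a a≉0)) ⟩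
      1# * z          ≈⟨ *-identityˡ z ⟩
      z               ∎

  -- Strong induction on the degree: in degree k every summand but the first involves coefficients
  -- of index below k, which already agree. Cancelling these leaves `g 0 * h k ≈ g 0 * h′ k`.
  *ₛ-cancelˡ : ∀ g {h h′} → ¬ g 0 ≈ 0# → g *ₛ h ≈ₛ g *ₛ h′ → h ≈ₛ h′
  *ₛ-cancelˡ g {h} {h′} g₀≉0 gh≈gh′ = <-rec _ step
    where
    step : ∀ k → (∀ {j} → j ℕ.< k → h j ≈ h′ j) → h k ≈ h′ k
    step k rec = *-cancelˡ (g 0) g₀≉0 (R.+-cancelʳ _ _ _
      (trans (gh≈gh′ k) (+-congˡ (sum-cong-≋ {k} λ i → *-congˡ (sym (rec (lower i)))))))
      where
      lower : ∀ {k} (i : Fin k) → k ℕ.∸ suc (toℕ i) ℕ.< k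
      lower {suc k} i = s≤s (ℕ.m∸n≤m k (toℕ i))

  -- Coefficients of polynomials and of their derivatives.

  coefficient-+ₓ : ∀ q r i → coefficient (q +ₓ r) i ≈ coefficient q i + coefficient r i
  coefficient-+ₓ []      r       i       = sym (+-identityˡ _)
  coefficient-+ₓ (a ∷ q) []      i       = sym (+-identityʳ _)
  coefficient-+ₓ (a ∷ q) (b ∷ r) zero    = refl
  coefficient-+ₓ (a ∷ q) (b ∷ r) (suc i) = coefficient-+ₓ q r i

  coefficient-• : ∀ a q i → coefficient (a • q) i ≈ a * coefficient q i
  coefficient-• a []      i       = sym (zeroʳ a)
  coefficient-• a (b ∷ q) zero    = refl
  coefficient-• a (b ∷ q) (suc i) = coefficient-• a q i

  coefficient-scaleFrom : ∀ k q i → coefficient (scaleFrom k q) i ≈ (i ℕ.+ k) · coefficient q i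
  coefficient-scaleFrom k []      i       = sym (·-zeroʳ (i ℕ.+ k))
  coefficient-scaleFrom k (a ∷ q) zero    = refl
  coefficient-scaleFrom k (a ∷ q) (suc i) = trans (coefficient-scaleFrom (suc k) q i)
    (×-congˡ {coefficient q i} (ℕ.+-suc i k))

  coefficient-derivative : ∀ q i → coefficient (derivative q) i ≈ suc i · coefficient q (suc i)
  coefficient-derivative []      i = sym (·-zeroʳ (suc i))
  coefficient-derivative (a ∷ q) i = trans (coefficient-scaleFrom 1 q i)
    (×-congˡ {coefficient q i} (ℕ.+-comm i 1))

  -- With c the coefficient of x^{i+k} in `q`, the left side is c (i+k+1)!/i! and the coefficient on
  -- the right is c (i+k)!/i!; their ratio is 1+k+i.
  coefficient-derivative^-∷ : ∀ k a q i → coefficient (derivative^ (suc k) (a ∷ q)) i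
                                        ≈ (suc k ℕ.+ i) · coefficient (derivative^ k q) i
  coefficient-derivative^-∷ zero    a q i = coefficient-derivative (a ∷ q) i
  coefficient-derivative^-∷ (suc k) a q i = begin
    coefficient (derivative^ (2 ℕ.+ k) (a ∷ q)) i
      ≈⟨ coefficient-derivative (derivative^ (suc k) (a ∷ q)) i ⟩
    suc i · coefficient (derivative^ (suc k) (a ∷ q)) (suc i)
      ≈⟨ ×-congʳ (suc i) (coefficient-derivative^-∷ k a q (suc i)) ⟩
    suc i · ((suc k ℕ.+ suc i) · w)          ≈⟨ ·-comm-· (suc i) (suc k ℕ.+ suc i) w ⟩
    (suc k ℕ.+ suc i) · (suc i · w)          ≈⟨ ×-congˡ {suc i · w} (ℕ.+-suc (suc k) i) ⟩
    (2 ℕ.+ k ℕ.+ i) · (suc i · w)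
      ≈⟨ ×-congʳ (2 ℕ.+ k ℕ.+ i) (coefficient-derivative (derivative^ k q) i) ⟨
    (2 ℕ.+ k ℕ.+ i) · coefficient (derivative^ (suc k) q) i ∎
    where w = coefficient (derivative^ k q) (suc i)

  coefficient-0∷derivative : ∀ q i → coefficient (0# ∷ derivative q) i ≈ i · coefficient q i
  coefficient-0∷derivative q zero    = refl
  coefficient-0∷derivative q (suc i) = coefficient-derivative q i

  -- Leibniz' rule for (a + x q)⁽¹⁺ᵏ⁾
  derivative^-∷ : ∀ k a q → derivative^ (suc k) (a ∷ q)
                          ≈ₓ (suc k · 1#) • derivative^ k q +ₓ (0# ∷ derivative^ (suc k) q)
  derivative^-∷ k a q i = begin
    coefficient (derivative^ (suc k) (a ∷ q)) i  ≈⟨ coefficient-derivative^-∷ k a q i ⟩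
    -- Splitting the factor (1+k)+i produces the two Leibniz terms: the first part scales q⁽ᵏ⁾, and
    -- the factor i comes from x d/dx applied to q⁽ᵏ⁾.
    (suc k ℕ.+ i) · w                            ≈⟨ ×-homo-+ w (suc k) i ⟩
    suc k · w + i · w
      ≈⟨ +-cong (trans (coefficient-• _ (derivative^ k q) i) (sym (·≈* (suc k) w)))
                (coefficient-0∷derivative (derivative^ k q) i) ⟨
    coefficient ((suc k · 1#) • derivative^ k q) i + coefficient (0# ∷ derivative^ (suc k) q) i
      ≈⟨ coefficient-+ₓ ((suc k · 1#) • derivative^ k q) _ i ⟨
    _                                            ∎
    where
    w = coefficient (derivative^ k q) i

  -- Evaluation and other linear functionals on polynomials.

  ⟦⟧-cong : ∀ q r x → q ≈ₓ r → ⟦ q ⟧ x ≈ ⟦ r ⟧ x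
  ⟦⟧-cong []      []      x q≈r = refl
  -- Since `≈ₓ` ignores trailing zeros, equal polynomials may have lists of different lengths; the
  -- surplus coefficients all vanish.
  ⟦⟧-cong []      (b ∷ r) x q≈r = sym (trans
    (+-cong (sym (q≈r 0)) (*-congˡ (sym (⟦⟧-cong [] r x (q≈r ∘ suc)))))
    (trans (+-identityˡ _) (zeroʳ x)))
  ⟦⟧-cong (a ∷ q) []      x q≈r = trans
    (+-cong (q≈r 0) (*-congˡ (⟦⟧-cong q [] x (q≈r ∘ suc))))
    (trans (+-identityˡ _) (zeroʳ x))
  ⟦⟧-cong (a ∷ q) (b ∷ r) x q≈r = +-cong (q≈r 0) (*-congˡ (⟦⟧-cong q r x (q≈r ∘ suc)))

  ⟦⟧-+ₓ : ∀ q r x → ⟦ q +ₓ r ⟧ x ≈ ⟦ q ⟧ x + ⟦ r ⟧ x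
  ⟦⟧-+ₓ []      r       x = sym (+-identityˡ _)
  ⟦⟧-+ₓ (a ∷ q) []      x = sym (+-identityʳ _)
  ⟦⟧-+ₓ (a ∷ q) (b ∷ r) x = begin
    a + b + x * ⟦ q +ₓ r ⟧ x               ≈⟨ +-congˡ (*-congˡ (⟦⟧-+ₓ q r x)) ⟩
    a + b + x * (⟦ q ⟧ x + ⟦ r ⟧ x)        ≈⟨ +-congˡ (distribˡ x _ _) ⟩
    a + b + (x * ⟦ q ⟧ x + x * ⟦ r ⟧ x)    ≈⟨ interchange _ _ _ _ ⟩
    a + x * ⟦ q ⟧ x + (b + x * ⟦ r ⟧ x)    ∎

  ⟦⟧-• : ∀ a q x → ⟦ a • q ⟧ x ≈ a * ⟦ q ⟧ x
  ⟦⟧-• a []      x = sym (zeroʳ a)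
  ⟦⟧-• a (b ∷ q) x = begin
    a * b + x * ⟦ a • q ⟧ x      ≈⟨ +-congˡ (*-congˡ (⟦⟧-• a q x)) ⟩
    a * b + x * (a * ⟦ q ⟧ x)    ≈⟨ +-congˡ (x∙yz≈y∙xz x a _) ⟩
    a * b + a * (x * ⟦ q ⟧ x)    ≈⟨ distribˡ a _ _ ⟨
    a * (b + x * ⟦ q ⟧ x)        ∎

  -- Evaluation at a point and extraction of a coefficient both have this form, so the expansion of
  -- `f ▷ q` into a finite sum is proved once for both.
  record IsLinear (φ : Polynomial → Carrier) : Set (c Level.⊔ ℓ) where
    field
      []-homo  : φ [] ≈ 0#
      +ₓ-homo  : ∀ q r → φ (q +ₓ r) ≈ φ q + φ r
      •-homo   : ∀ a q → φ (a • q) ≈ a * φ q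

    ▷-homo : ∀ f q → φ (f ▷ q) ≈ ∑[ k < length q ] (f (toℕ k) * φ (derivative^ (toℕ k) q))
    ▷-homo f q = trans (foldr-homo _ (length q))
      (sum-cong-≋ {length q} (λ k → •-homo (f (toℕ k)) _))
      where
      foldr-homo : ∀ F n → φ (foldr _+ₓ_ [] (applyUpTo F n)) ≈ ∑[ k < n ] φ (F (toℕ k))
      foldr-homo F zero    = []-homo
      foldr-homo F (suc n) = trans (+ₓ-homo (F 0) _) (+-congˡ (foldr-homo (F ∘ suc) n))

  ⟦⟧-isLinear : ∀ x → IsLinear (λ q → ⟦ q ⟧ x)
  ⟦⟧-isLinear x = record
    { []-homo = refl ; +ₓ-homo = λ q r → ⟦⟧-+ₓ q r x ; •-homo = λ a q → ⟦⟧-• a q x }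

  coefficient-isLinear : ∀ i → IsLinear (λ q → coefficient q i)
  coefficient-isLinear i = record
    { []-homo = refl ; +ₓ-homo = λ q r → coefficient-+ₓ q r i ; •-homo = λ a q → coefficient-• a q i }

  ▷-congʳ : ∀ {f g} q → f ≈ₛ g → f ▷ q ≈ₓ g ▷ q
  ▷-congʳ {f} {g} q f≈g i = begin
    coefficient (f ▷ q) i   ≈⟨ ▷-homo f q ⟩
    _                       ≈⟨ sum-cong-≋ {length q} (λ k → *-congʳ (f≈g (toℕ k))) ⟩
    _                       ≈⟨ ▷-homo g q ⟨
    coefficient (g ▷ q) i   ∎
    where open IsLinear (coefficient-isLinear i)

  -- Taylor expansion.

  derivative^-[] : ∀ k → derivative^ k [] ≡ []
  derivative^-[] zero    = ≡.refl
  derivative^-[] (suc k) = ≡.cong derivative (derivative^-[] k)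

  ⟦derivative^-∷⟧ : ∀ k a q x → ⟦ derivative^ (suc k) (a ∷ q) ⟧ x
                  ≈ suc k · ⟦ derivative^ k q ⟧ x + x * ⟦ derivative^ (suc k) q ⟧ x
  ⟦derivative^-∷⟧ k a q x = trans
    (⟦⟧-cong (derivative^ (suc k) (a ∷ q)) (r +ₓ s) x (derivative^-∷ k a q))
    (trans (⟦⟧-+ₓ r s x)
    (+-cong (trans (⟦⟧-• _ (derivative^ k q) x) (sym (·≈* (suc k) _))) (+-identityˡ _)))
    where
    r = (suc k · 1#) • derivative^ k q
    s = 0# ∷ derivative^ (suc k) q

  -- Induction along Horner's scheme, where a + x q takes the value a + (x+y) q(x+y) at x+y. The
  -- number of terms is any bound on the length because the induction hypothesis is used twice: with
  -- n+1 terms for the factor x and with n terms for the factor y.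
  taylor : ∀ q x y n → length q ℕ.≤ n →
           ⟦ q ⟧ (x + y) ≈ ∑[ k < n ] (egf (y ^_) (toℕ k) * ⟦ derivative^ (toℕ k) q ⟧ x)
  taylor []      x y n       _         = sym (∑-zero n λ k →
    trans (*-congˡ (reflexive (≡.cong (λ r → ⟦ r ⟧ x) (derivative^-[] (toℕ k))))) (zeroʳ _))
  taylor (a ∷ q) x y (suc n) (s≤s len) = sym (begin
    -- The term of order 0 stands apart, as Leibniz' rule is stated for positive orders only.
    e 0 * (a + x * A 0) + ∑[ k < n ] (e (suc (toℕ k)) * ⟦ derivative^ (suc (toℕ k)) (a ∷ q) ⟧ x)
      ≈⟨ +-cong head (sum-cong-≋ {n} (λ k → term (toℕ k))) ⟩
    a + x * (e 0 * A 0) + ∑[ k < n ] (y * t (toℕ k) + x * t (suc (toℕ k)))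
      ≈⟨ +-congˡ (∑-distrib-+ {n} _ _) ⟩
    a + x * t 0 + (∑[ k < n ] (y * t (toℕ k)) + ∑[ k < n ] (x * t (suc (toℕ k))))
      ≈⟨ +-congˡ (+-cong (*-distribˡ-sum {n} y _) (*-distribˡ-sum {n} x _)) ⟨
    a + x * t 0 + (y * S n + x * ∑[ k < n ] t (suc (toℕ k)))
      ≈⟨ +-assoc _ _ _ ⟩
    a + (x * t 0 + (y * S n + x * ∑[ k < n ] t (suc (toℕ k))))
      ≈⟨ +-congˡ (x∙yz≈xz∙y _ _ _) ⟩
    a + (x * t 0 + x * ∑[ k < n ] t (suc (toℕ k)) + y * S n)
      ≈⟨ +-congˡ (+-congʳ (distribˡ x _ _)) ⟨
    a + (x * S (suc n) + y * S n)
      ≈⟨ +-congˡ (+-cong (*-congˡ (taylor q x y (suc n) (ℕ.m≤n⇒m≤1+n len)))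
                         (*-congˡ (taylor q x y n len))) ⟨
    a + (x * ⟦ q ⟧ (x + y) + y * ⟦ q ⟧ (x + y))
      ≈⟨ +-congˡ (distribʳ _ x y) ⟨
    a + (x + y) * ⟦ q ⟧ (x + y) ∎)
    where
    e = egf (y ^_)
    A = λ k → ⟦ derivative^ k q ⟧ x
    t = λ k → e k * A k
    S = λ n → ∑[ k < n ] t (toℕ k)

    e₀≈1 : e 0 ≈ 1#
    e₀≈1 = trans (*-identityˡ _) 1/0!≈1

    head : e 0 * (a + x * A 0) ≈ a + x * (e 0 * A 0)
    head = trans (distribˡ _ _ _)
      (+-cong (trans (*-congʳ e₀≈1) (*-identityˡ a)) (x∙yz≈y∙xz _ _ _))

    -- The coefficient form of the differential equation d/dt e^{yt} = y e^{yt}.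
    [1+k]·e[1+k] : ∀ k → suc k · e (suc k) ≈ y * e k
    [1+k]·e[1+k] k = begin
      suc k · (y ^ suc k * 1/ suc k !)    ≈⟨ ×-comm-* (suc k) (y ^ suc k) _ ⟨
      y * y ^ k * (suc k · 1/ suc k !)    ≈⟨ *-congˡ ([1+k]·1/[1+k]! k) ⟩
      y * y ^ k * 1/ k !                  ≈⟨ *-assoc _ _ _ ⟩
      y * e k                             ∎

    term : ∀ k → e (suc k) * ⟦ derivative^ (suc k) (a ∷ q) ⟧ x ≈ y * t k + x * t (suc k)
    term k = begin
      e (suc k) * ⟦ derivative^ (suc k) (a ∷ q) ⟧ x
        ≈⟨ *-congˡ (⟦derivative^-∷⟧ k a q x) ⟩
      e (suc k) * (suc k · A k + x * A (suc k))           ≈⟨ distribˡ _ _ _ ⟩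
      e (suc k) * (suc k · A k) + e (suc k) * (x * A (suc k))
        ≈⟨ +-cong (×-comm-* (suc k) _ _) (x∙yz≈y∙xz _ _ _) ⟩
      suc k · (e (suc k) * A k) + x * t (suc k)           ≈⟨ +-congʳ (×-assoc-* (suc k) _ _) ⟨
      suc k · e (suc k) * A k + x * t (suc k)             ≈⟨ +-congʳ (*-congʳ ([1+k]·e[1+k] k)) ⟩
      y * e k * A k + x * t (suc k)                       ≈⟨ +-congʳ (*-assoc _ _ _) ⟩
      y * t k + x * t (suc k)                             ∎

module FermionicProperties {p : ℕ} {c ℓ : Level}
  (prime : Prime p) (odd : ¬ 2 ∣ p) (K : ℂₚ p c ℓ) where

  open ℂₚ K
  open Fermionic prime odd K
  open Congruence
  open Continuity using (bound; ℚ-cancel)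
  open SeriesProperties prime K
  open Algebra.Properties.Semiring.Sum semiring
    using (sum-cong-≋; ∑-distrib-+; *-distribˡ-sum)
  open Algebra.Properties.CommutativeSemigroup
    (CommutativeRing.*-commutativeSemigroup commutativeRing) using (x∙yz≈y∙xz)
  open Algebra.Properties.Semiring.Exp semiring using (^-congˡ)
  open IsRingMonomorphism embed-isMono using (1#-homo; 0#-homo)
  private module R = Algebra.Properties.Ring ring
  open Relation.Binary.Reasoning.Setoid setoid

  -- Limits and continuity.

  ~⇒≈ : ∀ {x y} → (∀ r → x ~⟨ r ⟩ y) → x ≈ y
  ~⇒≈ {x} {y} x~y = R.x∙y⁻¹≈ε⇒x≈y x y (Equivalence.to (v-∞ (x - y)) (unbounded _ x~y))
    where
    unbounded : ∀ (a : ℚ ⁺) → (∀ r → [ r ] ≤⁺ a) → a ≡ ⊤⁺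
    unbounded ⊤⁺    _   = ≡.refl
    -- A finite valuation r cannot be at least r + 1, so only ∞ exceeds every bound.
    unbounded [ r ] r≤a with r≤a (r ℚ.+ ℚ.1ℚ)
    ... | [ r+1≤r ] = contradiction (ℚ.<-≤-trans r<r+1 r+1≤r) (ℚ.<-irrefl ≡.refl)
      where
      r<r+1 : r ℚ.< r ℚ.+ ℚ.1ℚ
      r<r+1 = ≡.subst (ℚ._< r ℚ.+ ℚ.1ℚ) (ℚ.+-identityʳ r) (ℚ.+-monoʳ-< r (ℚ.positive⁻¹ ℚ.1ℚ))

  -- Beyond both thresholds one term of the sequence is `r`-close to both limits, and the
  -- ultrametric inequality keeps the same tolerance `r` between them.
  ⟶-unique : ∀ {s x y} → s ⟶ x → s ⟶ y → x ≈ y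
  ⟶-unique s⟶x s⟶y = ~⇒≈ λ r →
    let M , s~x = s⟶x r ; N , s~y = s⟶y r
    in ~-trans (~-sym (s~x (M ℕ.+ N) (ℕ.m≤m+n M N))) (s~y (M ℕ.+ N) (ℕ.m≤n+m N M))

  ⟶-cong : ∀ {s t x y} → (∀ n → s n ≈ t n) → x ≈ y → s ⟶ x → t ⟶ y
  ⟶-cong s≈t x≈y s⟶x r = let N , s~x = s⟶x r in
    N , λ n N≤n → ~-trans (~-reflexive (sym (s≈t n))) (~-trans (s~x n N≤n) (~-reflexive x≈y))

  ⟶-const : ∀ x → (λ _ → x) ⟶ x
  ⟶-const x r = 0 , λ _ _ → ~-reflexive refl

  ⟶-+ : ∀ {s t x y} → s ⟶ x → t ⟶ y → (λ n → s n + t n) ⟶ (x + y)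
  ⟶-+ s⟶x t⟶y r =
    let M , s~x = s⟶x r ; N , t~y = t⟶y r
    in M ℕ.+ N , λ n M+N≤n → ~-+ (s~x n (ℕ.m+n≤o⇒m≤o M M+N≤n)) (t~y n (ℕ.m+n≤o⇒n≤o M M+N≤n))

  ⟶-* : ∀ {s x} a → s ⟶ x → (λ n → a * s n) ⟶ (a * x)
  ⟶-* a s⟶x r =
    -- As `b` bounds the valuation of `a` from below, approximation to precision `r - b` makes up
    -- for the factor `a`.
    let b , b≤a = bound a ; N , s~x = s⟶x (r ℚ.- b)
    in N , λ n N≤n → ≤v-resp (*-minus _ _ _)
      (≡.subst (_≤v _) (ℚ-cancel r b) (≤v-* b≤a (s~x n N≤n)))

  -- Equal p-adic integers are congruent modulo every power of p, so their images are arbitrarily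
  -- close. This is needed because `f` is a function on representatives.
  continuous⇒cong : ∀ {f} → Continuous f → ∀ {y z} → y ≈ₚ z → f y ≈ f z
  continuous⇒cong cont y≈z = ~⇒≈ λ r → proj₂ (cont r) _ _ (y≈z (proj₁ (cont r)))

  -- The powers of p tend to 0 in ℤₚ: modulo pⁿ, every p^N with N ≥ n vanishes.
  continuous⇒⟶ : ∀ {f} → Continuous f → (λ N → f (fromℕ (p ℕ.^ N))) ⟶ f (fromℕ 0)
  continuous⇒⟶ cont r = let n , f~ = cont r in
    n , λ N n≤N → f~ _ _ (∣ₚ-weaken (N ℕ.∸ n) n (fromℕ (p ℕ.^ N) -ₚ fromℕ 0)
      (≡.subst (λ m → p ^ m ∣ₚ (fromℕ (p ℕ.^ N) -ₚ fromℕ 0)) (≡.sym (ℕ.m∸n+n≡m n≤N))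
        (≡.subst (+ (p ℕ.^ N) ℤ.∣_) (≡.sym (ℤ.+-identityʳ _)) ℤ.∣-refl)))

  -- The integral as a limit, and its linearity.

  -- a record rather than a synonym, so that f can be inferred from its type
  record HasIntegral (f : ℤₚ p → Carrier) (I : Carrier) : Set where
    constructor hasIntegral
    field
      converges : partialSum f ⟶ I

  open HasIntegral

  hasIntegral-∫ : ∀ f (cont : Continuous f) → HasIntegral f (∫ f cont)
  hasIntegral-∫ f cont = hasIntegral (proj₂ (complete (partialSum f) (partialSum-cauchy f cont)))

  hasIntegral-unique : ∀ {f I J} → HasIntegral f I → HasIntegral f J → I ≈ J
  hasIntegral-unique hI hJ = ⟶-unique (converges hI) (converges hJ)

  hasIntegral-cong : ∀ {f g I J} → (∀ y → f y ≈ g y) → I ≈ J → HasIntegral f I → HasIntegral g J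
  hasIntegral-cong f≈g I≈J hf = hasIntegral (⟶-cong
    (λ N → sum-cong-≋ {p ℕ.^ N} λ x → *-congʳ (f≈g (fromℕ (toℕ x)))) I≈J (converges hf))

  hasIntegral-0 : HasIntegral (λ _ → 0#) 0#
  hasIntegral-0 = hasIntegral (⟶-cong (λ N → sym (∑-zero (p ℕ.^ N) λ _ → zeroˡ _)) refl (⟶-const 0#))

  hasIntegral-+ : ∀ {f g I J} → HasIntegral f I → HasIntegral g J →
                  HasIntegral (λ y → f y + g y) (I + J)
  hasIntegral-+ {f} {g} hf hg = hasIntegral (⟶-cong (λ N → sym (trans
    (sum-cong-≋ {p ℕ.^ N} λ x → distribʳ ((- 1#) ^ toℕ x) (f (fromℕ (toℕ x))) (g (fromℕ (toℕ x))))
    (∑-distrib-+ {p ℕ.^ N} (λ x → f (fromℕ (toℕ x)) * (- 1#) ^ toℕ x)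
                           (λ x → g (fromℕ (toℕ x)) * (- 1#) ^ toℕ x))))
    refl (⟶-+ (converges hf) (converges hg)))

  hasIntegral-* : ∀ {f I} a → HasIntegral f I → HasIntegral (λ y → a * f y) (a * I)
  hasIntegral-* {f} a hf = hasIntegral (⟶-cong (λ N → trans
    (*-distribˡ-sum {p ℕ.^ N} a (λ x → f (fromℕ (toℕ x)) * (- 1#) ^ toℕ x))
    (sum-cong-≋ {p ℕ.^ N} λ x → sym (*-assoc a (f (fromℕ (toℕ x))) ((- 1#) ^ toℕ x))))
    refl (⟶-* a (converges hf)))

  hasIntegral-∑ : ∀ n {f : Fin n → ℤₚ p → Carrier} {I : Fin n → Carrier} →
                  (∀ i → HasIntegral (f i) (I i)) →
                  HasIntegral (λ y → ∑[ i < n ] f i y) (sum I)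
  hasIntegral-∑ zero    h = hasIntegral-0
  hasIntegral-∑ (suc n) h = hasIntegral-+ (h Fin.zero) (hasIntegral-∑ n (h ∘ suc))

  -- The shift equation of the integral.

  alt-telescope : ∀ n (g : ℕ → Carrier) → alt n (λ x → g (suc x) + g x) + (- 1#) ^ n * g n ≈ g 0
  alt-telescope zero    g = trans (+-identityˡ _) (*-identityˡ _)
  alt-telescope (suc n) g = begin
    -- The sum unfolds at its first term, so the induction hypothesis applies to `g ∘ suc`, once the
    -- extra sign has been pulled out.
    (g 1 + g 0) * 1# + ∑[ x < n ] (h (toℕ x) * (- 1# * (- 1#) ^ toℕ x)) + - 1# * (- 1#) ^ n * g (suc n)
      ≈⟨ +-cong (+-cong (*-identityʳ _) shifted) (*-assoc _ _ _) ⟩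
    g 1 + g 0 + - 1# * alt n h + - 1# * ((- 1#) ^ n * g (suc n))      ≈⟨ +-assoc _ _ _ ⟩
    g 1 + g 0 + (- 1# * alt n h + - 1# * ((- 1#) ^ n * g (suc n)))    ≈⟨ +-congˡ (distribˡ _ _ _) ⟨
    g 1 + g 0 + - 1# * (alt n h + (- 1#) ^ n * g (suc n))
      ≈⟨ +-cong (+-comm _ _) (trans (R.-1*x≈-x _) (-‿cong (alt-telescope n (g ∘ suc)))) ⟩
    g 0 + g 1 - g 1                                                   ≈⟨ +-assoc _ _ _ ⟩
    g 0 + (g 1 - g 1)                                                 ≈⟨ +-congˡ (-‿inverseʳ _) ⟩
    g 0 + 0#                                                          ≈⟨ +-identityʳ _ ⟩
    g 0                                                               ∎
    where
    h = λ x → g (2 ℕ.+ x) + g (suc x)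

    shifted : ∑[ x < n ] (h (toℕ x) * (- 1# * (- 1#) ^ toℕ x)) ≈ - 1# * alt n h
    shifted = sym (trans (*-distribˡ-sum {n} (- 1#) (λ x → h (toℕ x) * (- 1#) ^ toℕ x))
      (sum-cong-≋ {n} λ x → x∙yz≈y∙xz (- 1#) (h (toℕ x)) ((- 1#) ^ toℕ x)))

  -- Because p^N is odd, the boundary term of the telescoping sum carries the sign -1 and moves to
  -- the right with a plus.
  alt-telescope-p^ : ∀ N (g : ℕ → Carrier) →
                     alt (p ℕ.^ N) (λ x → g (suc x) + g x) ≈ g 0 + g (p ℕ.^ N)
  alt-telescope-p^ N g = begin
    A                      ≈⟨ +-identityʳ A ⟨
    A + 0#                 ≈⟨ +-congˡ (-‿inverseˡ _) ⟨
    A + (- G + G)          ≈⟨ +-assoc _ _ _ ⟨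
    A + - G + G            ≈⟨ +-congʳ (+-congˡ (trans (*-congʳ (-1^p^N N)) (R.-1*x≈-x G))) ⟨
    A + (- 1#) ^ (p ℕ.^ N) * G + G   ≈⟨ +-congʳ (alt-telescope (p ℕ.^ N) g) ⟩
    g 0 + G                ∎
    where
    A = alt (p ℕ.^ N) (λ x → g (suc x) + g x)
    G = g (p ℕ.^ N)

  -- The N-th partial sum is exactly f(0) + f(p^N), and continuity sends the second summand to f(0).
  hasIntegral-shift : ∀ {f} → Continuous f →
                      HasIntegral (λ y → f (fromℕ 1 +ₚ y) + f y) (f (fromℕ 0) + f (fromℕ 0))
  hasIntegral-shift {f} cont = hasIntegral (⟶-cong
    (λ N → sym (trans
      (sum-cong-≋ {p ℕ.^ N} λ x → *-congʳ {(- 1#) ^ toℕ x} (+-congʳ {f (fromℕ (toℕ x))}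
        -- The two arguments have the same residues but different coherence proofs, so they are only
        -- `≈ₚ`-equal.
        (continuous⇒cong cont {fromℕ 1 +ₚ fromℕ (toℕ x)} {fromℕ (suc (toℕ x))} (1+fromℕ (toℕ x)))))
      (alt-telescope-p^ N (f ∘ fromℕ))))
    refl
    (⟶-+ (⟶-const _) (continuous⇒⟶ cont)))
    where
    1+fromℕ : ∀ x → fromℕ 1 +ₚ fromℕ x ≈ₚ fromℕ (suc x)
    1+fromℕ x n = ℤ.divides (+ 0) (ℤ.+-inverseʳ (+ suc x))

  -- The generating function of the moments.

  hasIntegral-egf : ∀ k → HasIntegral (λ y → egf (ι y ^_) k) (∫eʸᵗ k)
  hasIntegral-egf k = hasIntegral-cong (λ y → *-comm _ _) (*-comm _ _)
    (hasIntegral-* (1/ k !) (hasIntegral-∫ _ (power-continuous k)))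

  [eᵗ+1]*egf-^ : ∀ x → (eᵗ +ₛ constant 1#) *ₛ egf (x ^_) ≈ₛ egf ((1# + x) ^_) +ₛ egf (x ^_)
  [eᵗ+1]*egf-^ x k = begin
    ((eᵗ +ₛ constant 1#) *ₛ egf (x ^_)) k     ≈⟨ *ₛ-distribʳ (egf (x ^_)) eᵗ (constant 1#) k ⟩
    (eᵗ *ₛ egf (x ^_)) k + (constant 1# *ₛ egf (x ^_)) k
      -- Replacing the coefficients 1 of `eᵗ` by powers of 1 presents it as `egf (1# ^_)`, to which
      -- the exponential law applies.
      ≈⟨ +-cong (*ₛ-congʳ (egf (x ^_)) (λ j → *-congʳ {1/ j !} (sym (1^ j))) k)
                (constant-*ₛ 1# (egf (x ^_)) k) ⟩
    (egf (1# ^_) *ₛ egf (x ^_)) k + 1# * egf (x ^_) k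
      ≈⟨ +-cong (egf-^-*ₛ 1# x k) (*-identityˡ _) ⟩
    egf ((1# + x) ^_) k + egf (x ^_) k        ∎

  -- One integrand, the degree-k coefficient of e^{(1+y)t} + e^{yt}, is integrated in two ways: by
  -- linearity, as a finite combination of moments, and by the shift equation, which gives 2 ·
  -- 0ᵏ/k!.
  [eᵗ+1]*∫eʸᵗ≈2 : (eᵗ +ₛ constant 1#) *ₛ ∫eʸᵗ ≈ₛ constant (1# + 1#)
  [eᵗ+1]*∫eʸᵗ≈2 k = trans (hasIntegral-unique viaSeries viaShift) (value k)
    where
    g = eᵗ +ₛ constant 1#
    a = ι (fromℕ 0) ^ k

    viaSeries : HasIntegral (λ y → egf ((1# + ι y) ^_) k + egf (ι y ^_) k) ((g *ₛ ∫eʸᵗ) k)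
    viaSeries = hasIntegral-cong (λ y → [eᵗ+1]*egf-^ (ι y) k) refl
      (hasIntegral-∑ (suc k) λ i → hasIntegral-* (g (toℕ i)) (hasIntegral-egf (k ℕ.∸ toℕ i)))

    ι[1+y] : ∀ y → ι (fromℕ 1 +ₚ y) ≈ 1# + ι y
    ι[1+y] y = trans (sym (ι-+ (fromℕ 1) y)) (+-congʳ 1#-homo)

    viaShift : HasIntegral (λ y → egf ((1# + ι y) ^_) k + egf (ι y ^_) k) (1/ k ! * (a + a))
    viaShift = hasIntegral-cong
      (λ y → trans (*-comm _ _) (trans (distribʳ (1/ k !) (ι (fromℕ 1 +ₚ y) ^ k) (ι y ^ k))
        (+-congʳ (*-congʳ (^-congˡ k (ι[1+y] y))))))
      refl
      (hasIntegral-* (1/ k !) (hasIntegral-shift (power-continuous k)))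

    -- Here 0⁰ = 1, so the constant term is 2; every higher power of 0 vanishes.
    value : ∀ k → 1/ k ! * (ι (fromℕ 0) ^ k + ι (fromℕ 0) ^ k) ≈ constant (1# + 1#) k
    value zero    = trans (*-congʳ 1/0!≈1) (*-identityˡ _)
    value (suc k) = trans (*-congˡ (trans (+-cong 0^ 0^) (+-identityˡ 0#))) (zeroʳ _)
      where
      0^ : ι (fromℕ 0) ^ suc k ≈ 0#
      0^ = trans (*-congʳ 0#-homo) (zeroˡ _)

  -- Both series become 2 after multiplication by eᵗ + 1, whose constant term is nonzero, so it can
  -- be cancelled.
  ∫eʸᵗ≈2/[eᵗ+1] : ∫eʸᵗ ≈ₛ 2/[eᵗ+1]
  ∫eʸᵗ≈2/[eᵗ+1] = *ₛ-cancelˡ g eᵗ+1-unit λ k →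
    trans ([eᵗ+1]*∫eʸᵗ≈2 k) (sym (*ₛ-quotient (constant (1# + 1#)) g eᵗ+1-unit k))
    where g = eᵗ +ₛ constant 1#

  -- Termwise integration of the Taylor expansion.

  ∫≈∫eʸᵗ▷ : ∀ q x → ∫ (λ y → ⟦ q ⟧ (x + ι y)) (polynomial-continuous q x) ≈ ⟦ ∫eʸᵗ ▷ q ⟧ x
  ∫≈∫eʸᵗ▷ q x = trans
    (hasIntegral-unique (hasIntegral-∫ _ (polynomial-continuous q x)) termwise)
    (trans (sum-cong-≋ {n} λ k → *-comm (⟦ derivative^ (toℕ k) q ⟧ x) (∫eʸᵗ (toℕ k)))
      (sym (▷-homo ∫eʸᵗ q)))
    where
    open IsLinear (⟦⟧-isLinear x)
    n = length q

    termwise : HasIntegral (λ y → ⟦ q ⟧ (x + ι y))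
      (∑[ k < n ] (⟦ derivative^ (toℕ k) q ⟧ x * ∫eʸᵗ (toℕ k)))
    termwise = hasIntegral-cong
      -- The expansion is cut at `length q`, where `▷` also stops. The factor free of y is moved to
      -- the left so that it acts as a scalar under the integral.
      (λ y → sym (trans (taylor q x (ι y) n ℕ.≤-refl)
        (sum-cong-≋ {n} λ k → *-comm (egf (ι y ^_) (toℕ k)) (⟦ derivative^ (toℕ k) q ⟧ x))))
      refl
      (hasIntegral-∑ n λ k → hasIntegral-* (⟦ derivative^ (toℕ k) q ⟧ x) (hasIntegral-egf (toℕ k)))

theorem2p2 :
    ∀ {c ℓ} (p : ℕ) (prime : Prime p) (odd : ¬ 2 ∣ p) (K : ℂₚ p c ℓ) →
    let open ℂₚ K
        open Fermionic prime odd K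
    in (q : Polynomial) →
       (∀ x → ∫ (λ y → ⟦ q ⟧ (x + ι y)) (polynomial-continuous q x) ≈ ⟦ ∫eʸᵗ ▷ q ⟧ x)
       × (∫eʸᵗ ▷ q ≈ₓ 2/[eᵗ+1] ▷ q)
theorem2p2 p isPrime odd K q = ∫≈∫eʸᵗ▷ q , ▷-congʳ q ∫eʸᵗ≈2/[eᵗ+1]
  where
  open SeriesProperties isPrime K
  open FermionicProperties isPrime odd K
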